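{- Let $(\rho_n)_{n\geqslant 0}$ be a sequence of non-zero numbers with $\rho_0=1$, and let $(K_m(x))_{m\geqslant 0}$ be a sequence of polynomials in $x$. For $n\geqslant 1$ let $F_n(x)=\det H_n(x)$, where $H_n(x)$ is the weighted Hessenberg matrix attached to $(\rho_n)$ and $(K_m(x))$ (defined in the context), let $F(x;z)=1+\sum_{n\geqslant 1}F_n(x)\frac{z^n}{\rho_n}$, and define $L_n(x)$, $n\geqslant 1$, by $$\frac{\partial}{\partial x}\ln F(x;z)=\sum_{n\geqslant 1}L_n(x)\frac{z^n}{\rho_n}.$$ Then for every $n\geqslant 1$, $$\frac{\mathrm{d}}{\mathrm{d}x}F_n(x)=\det \widetilde{H}_n(x),$$ where $\widetilde{H}_n(x)$ is the $n\times n$ matrix $$\widetilde{H}_n(x)= \begin{pmatrix} L_1(x) & -1 & 0 & \cdots & 0\\ L_2(x) & \frac{\rho_2}{\rho_1\rho_1}K_0(x) & -1 & \cdots & 0\\ L_3(x) & \frac{\rho_3}{\rho_1\rho_2}K_1(x) & \frac{\rho_3}{\rho_2\rho_1}K_0(x)& \cdots & 0\\ \vdots & \vdots & \vdots & \ddots & -1\\ L_{n}(x)& \frac{\rho_n}{\rho_1\rho_{n-1}}K_{n-2}(x) & \frac{\rho_n}{\rho_2\rho_{n-2}}K_{n-3}(x)& \cdots & \frac{\rho_n}{\rho_{n-1}\rho_1}K_0(x) \end{pmatrix},$$ that is, its $(i,1)$ entry is $L_i(x)$ for $1\leqslant i\leqslant n$; for $2\leqslant j\leqslant i$ its $(i,j)$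 entry is $\frac{\rho_i}{\rho_{j-1}\rho_{i-j+1}}K_{i-j}(x)$; its $(i,i+1)$ entries are $-1$; and its $(i,j)$ entries with $j>i+1$ are $0$. Moreover, for every $n\geqslant 1$, $L_n(x)$ is given by the $n\times n$ determinant $$L_n(x)= \begin{vmatrix} \frac{\mathrm{d}}{\mathrm{d}x} K_0(x) & -1 & 0 & \cdots & 0\\ \frac{\mathrm{d}}{\mathrm{d}x} K_1(x) & \frac{\rho_2}{\rho_1\rho_1}K_0(x) & -1 & \cdots & 0\\ \frac{\mathrm{d}}{\mathrm{d}x} K_2(x) & \frac{\rho_3}{\rho_1\rho_2}K_1(x) & \frac{\rho_3}{\rho_2\rho_1}K_0(x) & \cdots & 0\\ \vdots & \vdots & \vdots & \ddots & -1\\ \frac{\mathrm{d}}{\mathrm{d}x} K_{n-1}(x) & \frac{\rho_n}{\rho_1\rho_{n-1}}K_{n-2}(x) & \frac{\rho_n}{\rho_2\rho_{n-2}}K_{n-3}(x) & \cdots & \frac{\rho_n}{\rho_{n-1}\rho_1}K_0(x) \end{vmatrix}$$ (the matrix obtained from $\widetilde H_n(x)$ by replacing the first-column entry $L_i(x)$ by $\frac{\mathrm{d}}{\mathrm{d}x}K_{i-1}(x)$ for $1\leqslant i\leqslant n$), which is equivalent to $$L_n(x)=\frac{\mathrm{d}}{\mathrm{d}x} K_{n-1}(x)+\sum_{k=1}^{n-1}\frac{\rho_n}{\rho_k\rho_{n-k}}K_{n-k-1}(x)L_k(x).$$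
   Context: The weighted Hessenberg matrix $H_n(x)=(h_{ij})_{1\leqslant i,j\leqslant n}$ attached to $(\rho_n)_{n\geqslant0}$ and $(K_m(x))_{m\geqslant 0}$ is defined by $$h_{ij}=\begin{cases}\dfrac{\rho_i}{\rho_{j-1}\rho_{i-j+1}}K_{i-j}(x), & 1\leqslant j\leqslant i,\\ -1, & j=i+1,\\ 0, & j>i+1.\end{cases}$$ Generating functions are formal power series in $z$ whose coefficients are polynomials in $x$; $\frac{\partial}{\partial x}\ln F(x;z)$ means $\left(\frac{\partial}{\partial x}F(x;z)\right)/F(x;z)$, where $F(x;z)$ has constant term $1$ in $z$. Empty sums are $0$. -}

module Defs where

open import Level using (Level)
open import Data.Bool.Base using (if_then_else_)
open import Data.Fin.Base using (Fin; toℕ)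
open import Data.List.Base as List using (List; []; _∷_)
open import Data.Nat.Base as ℕ using (ℕ; zero; suc; _∸_; _≤ᵇ_; _≡ᵇ_)
open import Data.Product.Base using (proj₁)
open import Data.Vec.Base as Vec using (Vec; []; _∷_)
open import Data.Vec.Functional using (Vector; removeAt)
open import Algebra.Bundles using (RawRing; CommutativeRing)
open import Algebra.Apartness.Bundles using (HeytingField; HeytingCommutativeRing)
import Algebra.Apartness.Properties.HeytingCommutativeRing as HeytingProperties
import Algebra.Definitions.RawSemiring as RawSemiringDefs

private variable
  c ℓ ℓ₁ ℓ₂ : Level

module Determinant (R : RawRing c ℓ) where

  open RawRing R
  open RawSemiringDefs rawSemiring using (sum; _^_)

  Matrix : ℕ → Set c
  Matrix n = Vector (Vector Carrier n) n

  minor : ∀ {n} → Matrix (suc n) → Fin (suc n) → Matrix n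
  minor M j i = removeAt (M (Fin.suc i)) j

  -- Laplace expansion along the first row.
  det : ∀ {n} → Matrix n → Carrier
  det {zero}  M = 1#
  det {suc n} M =
    sum (λ j → (- 1#) ^ toℕ j * M Fin.zero j * det (minor M j))

-- Univariate polynomials: the list a₀ ∷ a₁ ∷ … ∷ a_d ∷ [] is
-- a₀ + a₁x + … + a_d x^d.  Trailing zeros are allowed, so equality
-- compares coefficients rather than lists.
module Polynomials (𝔽 : HeytingField c ℓ₁ ℓ₂) where

  open HeytingField 𝔽
  open RawSemiringDefs
    (RawRing.rawSemiring (CommutativeRing.rawRing
      (HeytingCommutativeRing.commutativeRing heytingCommutativeRing)))
    using (_×_)

  Poly : Set c
  Poly = List Carrier

  coeff : Poly → ℕ → Carrier
  coeff []      m       = 0#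
  coeff (a ∷ p) zero    = a
  coeff (a ∷ p) (suc m) = coeff p m

  infix 4 _≈ₚ_
  record _≈ₚ_ (p q : Poly) : Set ℓ₁ where
    constructor coeffwise
    field
      coeff-≈ : ∀ m → coeff p m ≈ coeff q m

  0ₚ 1ₚ : Poly
  0ₚ = []
  1ₚ = 1# ∷ []

  infixl 6 _+ₚ_
  _+ₚ_ : Poly → Poly → Poly
  []      +ₚ q       = q
  (a ∷ p) +ₚ []      = a ∷ p
  (a ∷ p) +ₚ (b ∷ q) = (a + b) ∷ (p +ₚ q)

  infix 8 -ₚ_
  -ₚ_ : Poly → Poly
  -ₚ p = List.map (λ a → - a) p

  infixr 7 _·_
  _·_ : Carrier → Poly → Poly
  a · p = List.map (a *_) p

  infixl 7 _*ₚ_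
  _*ₚ_ : Poly → Poly → Poly
  []      *ₚ q = []
  (a ∷ p) *ₚ q = a · q +ₚ (0# ∷ p *ₚ q)

  polyRawRing : RawRing c ℓ₁
  polyRawRing = record
    { Carrier = Poly
    ; _≈_     = _≈ₚ_
    ; _+_     = _+ₚ_
    ; _*_     = _*ₚ_
    ; -_      = -ₚ_
    ; 0#      = 0ₚ
    ; 1#      = 1ₚ
    }

  open RawSemiringDefs (RawRing.rawSemiring polyRawRing) public
    using () renaming (sum to sumₚ)

  open Determinant polyRawRing public using (Matrix; det)

  -- d/dx Σ_m a_m x^m = Σ_{m≥1} (m a_m) x^(m-1).
  d/dx : Poly → Poly
  d/dx []      = []
  d/dx (_ ∷ p) = from 1 p
    where
    from : ℕ → Poly → Poly
    from m []      = []
    from m (a ∷ q) = (m × a) ∷ from (suc m) q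

  -- Formal power series in z with polynomial coefficients: f n = [zⁿ] f.
  Series : Set c
  Series = ℕ → Poly

  infix 4 _≈ₛ_
  _≈ₛ_ : Series → Series → Set ℓ₁
  f ≈ₛ g = ∀ n → f n ≈ₚ g n

  infixl 7 _*ₛ_
  _*ₛ_ : Series → Series → Series
  (f *ₛ g) n = sumₚ {suc n} (λ i → f (toℕ i) *ₚ g (n ∸ toℕ i))

  ∂/∂x : Series → Series
  ∂/∂x f n = d/dx (f n)

  -- The coefficients g_n, …, g_0 of g = 1/f, for f with constant term 1:
  -- g_0 = 1 and g_(n+1) = - Σ_{i=0}^{n} f_(i+1) g_(n-i).
  inverseUpTo : Series → (n : ℕ) → Vec Poly (suc n)
  inverseUpTo f zero    = 1ₚ ∷ []
  inverseUpTo f (suc n) =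
    (-ₚ sumₚ (λ i → f (suc (toℕ i)) *ₚ Vec.lookup gs i)) ∷ gs
    where gs = inverseUpTo f n

  -- Meaningful only for series with constant term 1.
  inverse : Series → Series
  inverse f n = Vec.head (inverseUpTo f n)

  -- ∂/∂x ln f, for f with constant term 1.
  ∂/∂x-ln : Series → Series
  ∂/∂x-ln f = ∂/∂x f *ₛ inverse f

module Hessenberg
  (𝔽 : HeytingField c ℓ₁ ℓ₂)
  (ρ : ℕ → HeytingField.Carrier 𝔽)
  (ρ#0 : ∀ n → HeytingField._#_ 𝔽 (ρ n) (HeytingField.0# 𝔽))
  (K : ℕ → Polynomials.Poly 𝔽)
  where

  open HeytingField 𝔽
  open Polynomials 𝔽
  open HeytingProperties heytingCommutativeRing using (x#0y#0→xy#0)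

  -- x / y.  The library gives the inverse of the difference y - 0#.
  divide : (x y : Carrier) → y # 0# → Carrier
  divide x y y#0 = x * proj₁ (#⇒invertible y#0)

  -- ρ_i / (ρ_j ρ_k)
  weight : (i j k : ℕ) → Carrier
  weight i j k = divide (ρ i) (ρ j * ρ k) (x#0y#0→xy#0 (ρ#0 j) (ρ#0 k))

  -- Rows and columns are numbered from 1.
  matrix : (ℕ → ℕ → Poly) → (n : ℕ) → Matrix n
  matrix e n i j = e (suc (toℕ i)) (suc (toℕ j))

  h : ℕ → ℕ → Poly
  h i j =
    if j ≤ᵇ i then weight i (j ∸ 1) (suc i ∸ j) · K (i ∸ j)
    else if j ≡ᵇ suc i then -ₚ 1ₚ
    else 0ₚ

  H : (n : ℕ) → Matrix n
  H = matrix h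

  -- H with its first column replaced by (v 1, …, v n).
  H[_] : (ℕ → Poly) → (n : ℕ) → Matrix n
  H[ v ] = matrix (λ i j → if j ≡ᵇ 1 then v i else h i j)

  F : ℕ → Poly
  F n = det (H n)

  -- p + Σ_{n≥1} a_n zⁿ / ρ_n
  series : Poly → (ℕ → Poly) → Series
  series p a zero      = p
  series p a n@(suc _) = divide 1# (ρ n) (ρ#0 n) · a n

  -- d/dx K_{n-1} + Σ_{k=1}^{n-1} ρ_n / (ρ_k ρ_(n-k)) K_{n-k-1} a_k
  recurrence : (ℕ → Poly) → ℕ → Poly
  recurrence a n = d/dx (K (n ∸ 1)) +ₚ sumₚ {n ∸ 1} (λ i → term (suc (toℕ i)))
    where
    term : ℕ → Poly
    term k = weight n k (n ∸ k) · (K (n ∸ k ∸ 1) *ₚ a k)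

{-# OPTIONS --safe #-}

-- With f = F/ρ, k = Σ K_m z^m/ρ_(m+1) and l = ∂/∂x ln f = f′/f, eliminating the
-- superdiagonal entries turns each Hessenberg determinant into the solution of
-- a linear recurrence with kernel ρ_n K_(n-j-1) / (ρ_j ρ_(n-j)).  For F itself
-- this says f = 1 + z k f.  Differentiating and using f l = f′ gives
-- f′ = l + z k f′ and l = z k′ + z k l, which are the recurrences of the two
-- determinants with first columns L_i and K′_(i-1).
module Submission where

open import Defs
open import Algebra.Apartness.Bundles using (HeytingField; HeytingCommutativeRing)
open import Algebra.Bundles using (CommutativeMonoid; CommutativeRing; RawRing)
open import Algebra.Morphism.Structures using (IsRingMonomorphism)
open import Data.Bool.Base using (if_then_else_)
open import Data.Fin.Base using (Fin; zero; suc; toℕ; punchIn)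
open import Data.Fin.Properties using (toℕ<n)
open import Data.List.Base using ([]; _∷_)
open import Data.Nat.Base as ℕ using (ℕ; zero; suc; _∸_; _≡ᵇ_; _≤_; _<_; _≥_; z≤n; s≤s)
open import Data.Nat.Induction using (<-rec)
open import Data.Product.Base using (_×_; _,_; proj₁; proj₂)
open import Function.Base using (_∘_)
open import Function.Bundles using (_⇔_; mk⇔; Equivalence)
open import Level using (Level)
open import Relation.Binary.PropositionalEquality.Core as ≡ using (_≡_)
open import Relation.Nullary.Decidable using (dec-true; dec-false)
import Algebra.Apartness.Properties.HeytingCommutativeRing as HeytingProperties
import Algebra.Construct.Pointwise as Pointwise
import Algebra.Definitions.RawSemiring as RawSemiringDefinitions
import Algebra.Morphism.RingMonomorphism as RingMonomorphism
import Algebra.Properties.CommutativeMonoid.Mult as CommutativeMonoidMult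
import Algebra.Properties.CommutativeSemigroup as CommutativeSemigroupProperties
import Algebra.Properties.Ring as RingProperties
import Algebra.Properties.Semiring.Sum as SemiringSum
import Data.Nat.Properties as ℕ
import Data.Vec.Base as Vec
import Relation.Binary.Reasoning.Setoid as SetoidReasoning

private variable
  c ℓ ℓ₁ ℓ₂ : Level

-- Formal power series over a commutative ring, under the Cauchy product.

module Convolution (R : CommutativeRing c ℓ) where

  open CommutativeRing R hiding (zero)
  open SemiringSum semiring using (sum; sum-cong-≋)
  open SetoidReasoning setoid
  private
    module +-CS = CommutativeSemigroupProperties
      (CommutativeMonoid.commutativeSemigroup +-commutativeMonoid)

  Sequence : Set c
  Sequence = ℕ → Carrier

  infix 4 _≋_
  _≋_ : Sequence → Sequence → Set ℓ
  f ≋ g = ∀ n → f n ≈ g n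

  infixl 6 _⊕_
  _⊕_ : Sequence → Sequence → Sequence
  (f ⊕ g) n = f n + g n

  infixl 7 _⋆_
  -- The index follows the left factor, so `(f ⋆ g) (suc n)` computes to
  -- `f 0 * g (suc n) + (f ∘ suc ⋆ g) n`. The inductions below peel off the head of the left factor
  -- in this way. Over polynomials this is `_*ₛ_` by definition.
  _⋆_ : Sequence → Sequence → Sequence
  (f ⋆ g) n = sum {suc n} (λ i → f (toℕ i) * g (n ∸ toℕ i))

  unit : Sequence
  unit zero    = 1#
  unit (suc n) = 0#

  ⋆-cong : ∀ {f f′ g g′} → f ≋ f′ → g ≋ g′ → f ⋆ g ≋ f′ ⋆ g′
  ⋆-cong f≋f′ g≋g′ n =
    sum-cong-≋ {suc n} (λ i → *-cong (f≋f′ (toℕ i)) (g≋g′ (n ∸ toℕ i)))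

  ⋆-distribʳ : ∀ h f g → (f ⊕ g) ⋆ h ≋ f ⋆ h ⊕ g ⋆ h
  ⋆-distribʳ h f g zero = begin
    (f 0 + g 0) * h 0 + 0#                  ≈⟨ +-cong (distribʳ _ _ _) (sym (+-identityˡ 0#)) ⟩
    f 0 * h 0 + g 0 * h 0 + (0# + 0#)       ≈⟨ +-CS.interchange _ _ _ _ ⟩
    (f 0 * h 0 + 0#) + (g 0 * h 0 + 0#)     ∎
  ⋆-distribʳ h f g (suc n) =
    trans (+-cong (distribʳ _ _ _) (⋆-distribʳ h (f ∘ suc) (g ∘ suc) n))
          (+-CS.interchange _ _ _ _)

  ⋆-scale : ∀ a f g n → ((a *_) ∘ f ⋆ g) n ≈ a * (f ⋆ g) n
  ⋆-scale a f g zero = begin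
    a * f 0 * g 0 + 0#        ≈⟨ +-cong (*-assoc _ _ _) (sym (zeroʳ a)) ⟩
    a * (f 0 * g 0) + a * 0#  ≈⟨ distribˡ _ _ _ ⟨
    a * (f 0 * g 0 + 0#)      ∎
  ⋆-scale a f g (suc n) =
    trans (+-cong (*-assoc _ _ _) (⋆-scale a (f ∘ suc) g n)) (sym (distribˡ _ _ _))

  -- The mirror image of the definitional unfolding: the last term is split off instead of the
  -- first. Commutativity follows by playing one against the other.
  ⋆-sucʳ : ∀ f g n → (f ⋆ g) (suc n) ≈ f (suc n) * g 0 + (f ⋆ (g ∘ suc)) n
  ⋆-sucʳ f g zero    = +-CS.x∙yz≈y∙xz _ _ _
  ⋆-sucʳ f g (suc n) =
    trans (+-congˡ (⋆-sucʳ (f ∘ suc) g n)) (+-CS.x∙yz≈y∙xz _ _ _)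

  ⋆-comm : ∀ f g → f ⋆ g ≋ g ⋆ f
  ⋆-comm f g zero    = +-congʳ (*-comm _ _)
  ⋆-comm f g (suc n) =
    trans (+-cong (*-comm _ _) (⋆-comm (f ∘ suc) g n)) (sym (⋆-sucʳ g f n))

  -- The tail of `f ⋆ g` is `f 0` times the tail of `g` plus the product of the tail of `f` with
  -- `g`. Distributivity and scaling handle the first part, the induction hypothesis the second.
  ⋆-assoc : ∀ f g h → (f ⋆ g) ⋆ h ≋ f ⋆ (g ⋆ h)
  ⋆-assoc f g h zero = +-congʳ (begin
    (f 0 * g 0 + 0#) * h 0  ≈⟨ *-congʳ (+-identityʳ _) ⟩
    f 0 * g 0 * h 0         ≈⟨ *-assoc _ _ _ ⟩
    f 0 * (g 0 * h 0)       ≈⟨ *-congˡ (+-identityʳ _) ⟨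
    f 0 * (g 0 * h 0 + 0#)  ∎)
  ⋆-assoc f g h (suc n) = begin
    (f 0 * g 0 + 0#) * h (suc n) + (((f 0 *_) ∘ g ∘ suc ⊕ (f ∘ suc ⋆ g)) ⋆ h) n
      ≈⟨ +-cong (trans (*-congʳ (+-identityʳ _)) (*-assoc _ _ _))
                (⋆-distribʳ h ((f 0 *_) ∘ g ∘ suc) (f ∘ suc ⋆ g) n) ⟩
    f 0 * (g 0 * h (suc n)) + (((f 0 *_) ∘ g ∘ suc ⋆ h) n + ((f ∘ suc ⋆ g) ⋆ h) n)
      ≈⟨ +-assoc _ _ _ ⟨
    f 0 * (g 0 * h (suc n)) + ((f 0 *_) ∘ g ∘ suc ⋆ h) n + ((f ∘ suc ⋆ g) ⋆ h) n
      ≈⟨ +-cong (+-congˡ (⋆-scale (f 0) (g ∘ suc) h n)) (⋆-assoc (f ∘ suc) g h n) ⟩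
    f 0 * (g 0 * h (suc n)) + f 0 * (g ∘ suc ⋆ h) n + (f ∘ suc ⋆ (g ⋆ h)) n
      ≈⟨ +-congʳ (distribˡ _ _ _) ⟨
    f 0 * (g ⋆ h) (suc n) + (f ∘ suc ⋆ (g ⋆ h)) n
      ∎

  ⋆-identityʳ : ∀ f → f ⋆ unit ≋ f
  ⋆-identityʳ f zero    = trans (+-identityʳ _) (*-identityʳ _)
  ⋆-identityʳ f (suc n) =
    trans (+-cong (zeroʳ _) (⋆-identityʳ (f ∘ suc) n)) (+-identityˡ _)

  powerSeriesRing : CommutativeRing c ℓ
  powerSeriesRing = record
    { Carrier = Sequence
    ; _≈_     = _≋_
    ; _+_     = _⊕_
    ; _*_     = _⋆_
    ; -_      = λ f n → - f n
    ; 0#      = λ _ → 0#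
    ; 1#      = unit
    ; isCommutativeRing = record
      { isRing = record
        { +-isAbelianGroup = Pointwise.isAbelianGroup ℕ +-isAbelianGroup
        ; *-cong     = ⋆-cong
        ; *-assoc    = ⋆-assoc
        ; *-identity = (λ f n → trans (⋆-comm unit f n) (⋆-identityʳ f n))
                       , ⋆-identityʳ
        ; distrib    = (λ h f g n → trans (⋆-comm h (f ⊕ g) n)
                           (trans (⋆-distribʳ h f g n)
                             (+-cong (⋆-comm f h n) (⋆-comm g h n))))
                       , ⋆-distribʳ
        }
      ; *-comm = ⋆-comm
      }
    }

  -- Derivations acting on coefficients, and logarithmic derivatives.

  module Derivation
    (D : Carrier → Carrier)
    (D-cong : ∀ {x y} → x ≈ y → D x ≈ D y)
    (D-0 : D 0# ≈ 0#)
    (D-+ : ∀ x y → D (x + y) ≈ D x + D y)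
    (D-* : ∀ x y → D (x * y) ≈ D x * y + x * D y)
    where

    D-⋆ : ∀ f g n → D ((f ⋆ g) n) ≈ (D ∘ f ⋆ g) n + (f ⋆ (D ∘ g)) n
    D-⋆ f g zero = begin
      D (f 0 * g 0 + 0#)                               ≈⟨ D-+ _ _ ⟩
      D (f 0 * g 0) + D 0#                             ≈⟨ +-cong (D-* _ _) (trans D-0 (sym (+-identityˡ 0#))) ⟩
      D (f 0) * g 0 + f 0 * D (g 0) + (0# + 0#)        ≈⟨ +-CS.interchange _ _ _ _ ⟩
      (D (f 0) * g 0 + 0#) + (f 0 * D (g 0) + 0#)      ∎
    D-⋆ f g (suc n) =
      trans (D-+ _ _) (trans (+-cong (D-* _ _) (D-⋆ (f ∘ suc) g n))
                             (+-CS.interchange _ _ _ _))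

    -- The series f = 1 + z k f, that is f = 1/(1 - z k), with inverse g.
    module LogarithmicDerivative
      (f g k : Sequence)
      (D-f₀ : D (f 0) ≈ 0#) (f₀≈1 : f 0 ≈ 1#)
      (f-suc : ∀ n → f (suc n) ≈ (f ⋆ k) n)
      (f⋆g≋unit : f ⋆ g ≋ unit)
      where

      private
        module S = CommutativeRing powerSeriesRing
        module ≋ = SetoidReasoning S.setoid

      l : Sequence
      l = D ∘ f ⋆ g

      f⋆l≋Df : f ⋆ l ≋ D ∘ f
      f⋆l≋Df = ≋.begin
        f ⋆ (D ∘ f ⋆ g)   ≋.≈⟨ ⋆-cong {f} (λ _ → refl) (⋆-comm (D ∘ f) g) ⟩
        f ⋆ (g ⋆ (D ∘ f)) ≋.≈⟨ ⋆-assoc f g (D ∘ f) ⟨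
        (f ⋆ g) ⋆ (D ∘ f) ≋.≈⟨ ⋆-cong {g = D ∘ f} f⋆g≋unit (λ _ → refl) ⟩
        unit ⋆ (D ∘ f)    ≋.≈⟨ S.*-identityˡ (D ∘ f) ⟩
        D ∘ f             ≋.∎

      -- Coefficient n + 1 of f l = f′. The head contributes `l (suc n)` because `f 0` is 1; the
      -- tail of `f` is k f, so the remaining terms form k f l = k f′.
      Df-suc : ∀ n → D (f (suc n)) ≈ l (suc n) + (D ∘ f ⋆ k) n
      Df-suc n = begin
        D (f (suc n))                          ≈⟨ f⋆l≋Df (suc n) ⟨
        f 0 * l (suc n) + (f ∘ suc ⋆ l) n
          ≈⟨ +-cong (trans (*-congʳ f₀≈1) (*-identityˡ _)) (shift-f⋆l n) ⟩
        l (suc n) + (D ∘ f ⋆ k) n              ∎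
        where
        shift-f⋆l : f ∘ suc ⋆ l ≋ D ∘ f ⋆ k
        shift-f⋆l = ≋.begin
          f ∘ suc ⋆ l    ≋.≈⟨ ⋆-cong {g = l} f-suc (λ _ → refl) ⟩
          (f ⋆ k) ⋆ l    ≋.≈⟨ ⋆-cong {g = l} (⋆-comm f k) (λ _ → refl) ⟩
          (k ⋆ f) ⋆ l    ≋.≈⟨ ⋆-assoc k f l ⟩
          k ⋆ (f ⋆ l)    ≋.≈⟨ ⋆-cong {k} (λ _ → refl) f⋆l≋Df ⟩
          k ⋆ (D ∘ f)    ≋.≈⟨ ⋆-comm k (D ∘ f) ⟩
          D ∘ f ⋆ k      ≋.∎

      -- The head of f′ g vanishes because `f 0` has derivative 0. The tail of `f` is f k, whose
      -- derivative f k′ + f′ k becomes k′ + l k after multiplication by g = 1/f.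
      l-suc : ∀ n → l (suc n) ≈ D (k n) + (l ⋆ k) n
      l-suc n = begin
        D (f 0) * g (suc n) + (D ∘ f ∘ suc ⋆ g) n
          ≈⟨ trans (+-congʳ (trans (*-congʳ D-f₀) (zeroˡ _))) (+-identityˡ _) ⟩
        (D ∘ f ∘ suc ⋆ g) n
          ≈⟨ ⋆-cong {g = g} (λ m → trans (D-cong (f-suc m)) (trans (D-⋆ f k m) (+-comm _ _)))
                            (λ _ → refl) n ⟩
        ((f ⋆ (D ∘ k) ⊕ D ∘ f ⋆ k) ⋆ g) n
          ≈⟨ ⋆-distribʳ g (f ⋆ (D ∘ k)) (D ∘ f ⋆ k) n ⟩
        ((f ⋆ (D ∘ k)) ⋆ g) n + ((D ∘ f ⋆ k) ⋆ g) n
          ≈⟨ +-cong (cancel-g n) (xy∙z≈xz∙y (D ∘ f) k g n) ⟩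
        D (k n) + (l ⋆ k) n
          ∎
        where
        open CommutativeSemigroupProperties S.*-commutativeSemigroup using (xy∙z≈xz∙y)
        cancel-g : (f ⋆ (D ∘ k)) ⋆ g ≋ D ∘ k
        cancel-g = ≋.begin
          (f ⋆ (D ∘ k)) ⋆ g  ≋.≈⟨ xy∙z≈xz∙y f (D ∘ k) g ⟩
          (f ⋆ g) ⋆ (D ∘ k)  ≋.≈⟨ ⋆-cong {g = D ∘ k} f⋆g≋unit (λ _ → refl) ⟩
          unit ⋆ (D ∘ k)     ≋.≈⟨ S.*-identityˡ (D ∘ k) ⟩
          D ∘ k              ≋.∎

-- Determinants of Hessenberg matrices with superdiagonal -1.

module HessenbergDeterminant (R : CommutativeRing c ℓ) where

  open CommutativeRing R hiding (zero)
  open Determinant rawRing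
  open RawSemiringDefinitions (RawRing.rawSemiring rawRing) using (_^_)
  open SemiringSum semiring
    using (sum; sum-cong-≋; sum-replicate-zero; ∑-distrib-+; *-distribˡ-sum)
  open RingProperties ring using (-1*x≈-x; -‿involutive)
  open SetoidReasoning setoid

  det-cong : ∀ {n} {M N : Matrix n} → (∀ i j → M i j ≈ N i j) → det M ≈ det N
  det-cong {zero}  M≈N = refl
  det-cong {suc n} M≈N = sum-cong-≋ {suc n} λ j →
    *-cong (*-congˡ {(- 1#) ^ toℕ j} (M≈N zero j)) (det-cong {n} (λ i k → M≈N (suc i) (punchIn j k)))

  -- Expansion is along the first row, so linearity in the first column goes by induction on the
  -- size. The minor at column 0 has lost that column and only the corner entry splits; every other
  -- minor keeps it and splits by induction.
  det-linear-column₀ : ∀ {n} x {A B M : Matrix (suc n)} →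
    (∀ i j → A i (suc j) ≈ M i (suc j)) →
    (∀ i j → B i (suc j) ≈ M i (suc j)) →
    (∀ i → M i zero ≈ x * A i zero + B i zero) →
    det M ≈ x * det A + det B
  det-linear-column₀ {n} x {A} {B} {M} A≈M B≈M M₀≈xA₀+B₀ = begin
    det M                            ≈⟨ sum-cong-≋ {suc n} term-linear ⟩
    sum (λ j → x * term A j + term B j)
      ≈⟨ ∑-distrib-+ (λ j → x * term A j) (term B) ⟩
    sum (λ j → x * term A j) + det B ≈⟨ +-congʳ (*-distribˡ-sum x (term A)) ⟨
    x * det A + det B                ∎
    where
    open CommutativeSemigroupProperties *-commutativeSemigroup using (x∙yz≈y∙xz)

    term : Matrix (suc n) → Fin (suc n) → Carrier
    term N j = (- 1#) ^ toℕ j * N zero j * det (minor N j)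

    term-linear : ∀ j → term M j ≈ x * term A j + term B j
    term-linear zero = begin
      1# * M zero zero * det (minor M zero)
        ≈⟨ *-congʳ (trans (*-identityˡ _) (M₀≈xA₀+B₀ zero)) ⟩
      (x * a + b) * det (minor M zero)
        ≈⟨ distribʳ _ _ _ ⟩
      x * a * det (minor M zero) + b * det (minor M zero)
        ≈⟨ +-cong (*-congˡ (det-cong {n} (λ i k → A≈M (suc i) k)))
                  (*-congˡ (det-cong {n} (λ i k → B≈M (suc i) k))) ⟨
      x * a * det (minor A zero) + b * det (minor B zero)
        ≈⟨ +-cong (*-assoc _ _ _) (*-congʳ (sym (*-identityˡ b))) ⟩
      x * (a * det (minor A zero)) + term B zero
        ≈⟨ +-congʳ (*-congˡ (*-congʳ (*-identityˡ a))) ⟨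
      x * term A zero + term B zero
        ∎
      where
      a = A zero zero
      b = B zero zero
    -- A nonzero column index forces `n` to be a successor, so the minor still has a first column
    -- for the induction hypothesis to act on.
    term-linear j@(suc {n = suc _} j′) = begin
      s * M zero j * det (minor M j)
        ≈⟨ *-congˡ (det-linear-column₀ x {minor A j} {minor B j} {minor M j}
                     (λ i k → A≈M (suc i) (punchIn j′ k)) (λ i k → B≈M (suc i) (punchIn j′ k))
                     (λ i → M₀≈xA₀+B₀ (suc i))) ⟩
      s * M zero j * (x * det (minor A j) + det (minor B j))
        ≈⟨ distribˡ _ _ _ ⟩
      s * M zero j * (x * det (minor A j)) + s * M zero j * det (minor B j)
        ≈⟨ +-cong (trans (x∙yz≈y∙xz _ _ _) (*-congˡ (*-congʳ (*-congˡ (sym (A≈M zero j′))))))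
                  (*-congʳ (*-congˡ (sym (B≈M zero j′)))) ⟩
      x * term A j + term B j
        ∎
      where s = (- 1#) ^ toℕ j

  -- One infinite array, indexed from 0, supplies matrices of all sizes, so that determinants of
  -- different sizes can be related.
  entries : (ℕ → ℕ → Carrier) → ∀ n → Matrix n
  entries e n i j = e (toℕ i) (toℕ j)

  IsHessenberg : (ℕ → ℕ → Carrier) → Set ℓ
  IsHessenberg e = (∀ i → e i (suc i) ≈ - 1#)
                 × (∀ i j → suc i < j → e i j ≈ 0#)

  -- The effect of using the -1 in the first row to clear e 0 0.
  eliminate : (ℕ → ℕ → Carrier) → ℕ → ℕ → Carrier
  eliminate e i zero    = e 0 0 * e (suc i) 1 + e (suc i) 0
  eliminate e i (suc j) = e (suc i) (suc (suc j))

  eliminate-isHessenberg : ∀ {e} → IsHessenberg e → IsHessenberg (eliminate e)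
  eliminate-isHessenberg (super , above) =
    (λ i → super (suc i)) , λ { i (suc j) i<j → above (suc i) (suc (suc j)) (s≤s i<j) }

  -- Only the first two entries of row 0 contribute, and the sign of the second cancels its value
  -- -1, leaving `e 0 0 * det A + det B`. The minors `A` and `B` differ only in their first column,
  -- so linearity there merges them into one determinant.
  det-eliminate : ∀ {e} → IsHessenberg e → ∀ n →
    det (entries e (suc (suc n))) ≈ det (entries (eliminate e) (suc n))
  det-eliminate {e} (super , above) n = begin
    1# * e 0 0 * det A + (- 1# * 1# * e 0 1 * det B + sum rest)
      ≈⟨ +-cong (*-congʳ (*-identityˡ _)) (+-cong (*-congʳ sign) rest≈0) ⟩
    e 0 0 * det A + (1# * det B + 0#)
      ≈⟨ +-congˡ (trans (+-identityʳ _) (*-identityˡ _)) ⟩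
    e 0 0 * det A + det B
      ≈⟨ det-linear-column₀ (e 0 0) {A} {B} {entries (eliminate e) (suc n)}
           (λ i j → refl) (λ i j → refl) (λ i → refl) ⟨
    det (entries (eliminate e) (suc n))
      ∎
    where
    M : Matrix (suc (suc n))
    M = entries e (suc (suc n))
    A B : Matrix (suc n)
    A = minor M zero
    B = minor M (suc zero)

    rest : Fin n → Carrier
    rest j = (- 1#) ^ toℕ (suc (suc j)) * M zero (suc (suc j)) * det (minor M (suc (suc j)))

    rest≈0 : sum rest ≈ 0#
    rest≈0 = trans
      (sum-cong-≋ {n} λ j → trans (*-congʳ (trans (*-congˡ (above 0 _ (s≤s (s≤s z≤n)))) (zeroʳ _))) (zeroˡ _))
      (sum-replicate-zero n)

    sign : - 1# * 1# * e 0 1 ≈ 1#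
    sign = begin
      - 1# * 1# * e 0 1  ≈⟨ *-cong (*-identityʳ _) (super 0) ⟩
      - 1# * - 1#        ≈⟨ -1*x≈-x _ ⟩
      - - 1#             ≈⟨ -‿involutive _ ⟩
      1#                 ∎

  -- Induction on the size, applied to the eliminated array: its determinant of size i + 1 is that
  -- of `e` of size i + 2, so its recurrence is the one for `e` shifted by one.
  det-recurrence : ∀ {e} → IsHessenberg e → ∀ n →
    det (entries e (suc n)) ≈
    e n 0 + sum {n} (λ i → e n (suc (toℕ i)) * det (entries e (suc (toℕ i))))
  det-recurrence {e} hess zero =
    +-congʳ (trans (*-identityʳ _) (*-identityˡ _))
  det-recurrence {e} hess (suc n) = begin
    det (entries e (suc (suc n)))
      ≈⟨ det-eliminate hess n ⟩
    det (entries (eliminate e) (suc n))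
      ≈⟨ det-recurrence (eliminate-isHessenberg hess) n ⟩
    e 0 0 * e (suc n) 1 + e (suc n) 0
      + sum {n} (λ i → e (suc n) (suc (suc (toℕ i))) * det (entries (eliminate e) (suc (toℕ i))))
      ≈⟨ +-cong (+-comm _ _) (sum-cong-≋ {n} λ i → *-congˡ (sym (det-eliminate hess (toℕ i)))) ⟩
    e (suc n) 0 + e 0 0 * e (suc n) 1
      + sum {n} (λ i → e (suc n) (suc (suc (toℕ i))) * det (entries e (suc (suc (toℕ i)))))
      ≈⟨ +-assoc _ _ _ ⟩
    e (suc n) 0 + (e 0 0 * e (suc n) 1
      + sum {n} (λ i → e (suc n) (suc (suc (toℕ i))) * det (entries e (suc (suc (toℕ i))))))
      -- The product created by the elimination is the missing summand of index 0, since the 1 by 1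
      -- determinant is `e 0 0`.
      ≈⟨ +-congˡ (+-congʳ (trans (*-comm _ _) (*-congˡ (sym det₁)))) ⟩
    e (suc n) 0 + sum {suc n} (λ i → e (suc n) (suc (toℕ i)) * det (entries e (suc (toℕ i))))
      ∎
    where
    det₁ : det (entries e 1) ≈ e 0 0
    det₁ = trans (det-recurrence hess zero) (+-identityʳ _)

  -- Strong induction: the sum at `m` involves only terms of index 1 to m, all smaller than m + 1.
  recurrence-unique : (u : ℕ → Carrier) (κ : ∀ m → Fin m → Carrier) {x y : ℕ → Carrier} →
    (∀ m → x (suc m) ≈ u m + sum {m} (λ i → κ m i * x (suc (toℕ i)))) →
    (∀ m → y (suc m) ≈ u m + sum {m} (λ i → κ m i * y (suc (toℕ i)))) →
    ∀ m → x (suc m) ≈ y (suc m)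
  recurrence-unique u κ {x} {y} x-rec y-rec = <-rec _ λ m x≈y →
    trans (x-rec m) (trans (+-congˡ (sum-cong-≋ {m} λ i → *-congˡ (x≈y (toℕ<n i)))) (sym (y-rec m)))

-- The commutative ring of polynomials.

module PolynomialRing (𝔽 : HeytingField c ℓ₁ ℓ₂) where

  open HeytingField 𝔽 using (heytingCommutativeRing)
  open Polynomials 𝔽
  open _≈ₚ_ public

  fieldRing : CommutativeRing c ℓ₁
  fieldRing = HeytingCommutativeRing.commutativeRing heytingCommutativeRing

  open CommutativeRing fieldRing hiding (zero)
  open RingProperties ring using (-0#≈0#)
  open Convolution fieldRing using (_⋆_; powerSeriesRing)

  coeff-+ : ∀ p q m → coeff (p +ₚ q) m ≈ coeff p m + coeff q m
  coeff-+ []      q       m       = sym (+-identityˡ _)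
  coeff-+ (a ∷ p) []      m       = sym (+-identityʳ _)
  coeff-+ (a ∷ p) (b ∷ q) zero    = refl
  coeff-+ (a ∷ p) (b ∷ q) (suc m) = coeff-+ p q m

  coeff-· : ∀ a p m → coeff (a · p) m ≈ a * coeff p m
  coeff-· a []      m       = sym (zeroʳ a)
  coeff-· a (b ∷ p) zero    = refl
  coeff-· a (b ∷ p) (suc m) = coeff-· a p m

  coeff-neg : ∀ p m → coeff (-ₚ p) m ≈ - coeff p m
  coeff-neg []      m       = sym -0#≈0#
  coeff-neg (a ∷ p) zero    = refl
  coeff-neg (a ∷ p) (suc m) = coeff-neg p m

  coeff-* : ∀ p q m → coeff (p *ₚ q) m ≈ (coeff p ⋆ coeff q) m
  coeff-* []      q m = sym (CommutativeRing.zeroˡ powerSeriesRing (coeff q) m)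
  coeff-* (a ∷ p) q m =
    trans (coeff-+ (a · q) (0# ∷ p *ₚ q) m) (trans (+-congʳ (coeff-· a q m)) (shifted m))
    where
    shifted : ∀ m → a * coeff q m + coeff (0# ∷ p *ₚ q) m ≈ (coeff (a ∷ p) ⋆ coeff q) m
    shifted zero    = refl
    shifted (suc m) = +-congˡ (coeff-* p q m)

  -- Equality of polynomials is coefficientwise, so `coeff` is an injective homomorphism into power
  -- series over the field, and the ring laws are pulled back along it.
  polyRing : CommutativeRing c ℓ₁
  polyRing = record
    { RawRing polyRawRing
    ; isCommutativeRing = RingMonomorphism.isCommutativeRing isRingMonomorphism
        (CommutativeRing.isCommutativeRing powerSeriesRing)
    }
    where
    isRingMonomorphism :
      IsRingMonomorphism polyRawRing (CommutativeRing.rawRing powerSeriesRing) coeff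
    isRingMonomorphism = record
      { isRingHomomorphism = record
        { isSemiringHomomorphism = record
          { isNearSemiringHomomorphism = record
            { +-isMonoidHomomorphism = record
              { isMagmaHomomorphism = record
                { isRelHomomorphism = record { cong = coeff-≈ }
                ; homo = coeff-+
                }
              ; ε-homo = λ m → refl
              }
            ; *-homo = coeff-*
            }
          ; 1#-homo = λ { zero → refl ; (suc m) → refl }
          }
        ; -‿homo = coeff-neg
        }
      ; injective = coeffwise
      }

  private
    module P = CommutativeRing polyRing
    module ≈ₚ = SetoidReasoning P.setoid

  ·-cong : ∀ {a b p q} → a ≈ b → p ≈ₚ q → a · p ≈ₚ b · q
  ·-cong {a} {b} {p} {q} a≈b p≈q .coeff-≈ m =
    trans (coeff-· a p m) (trans (*-cong a≈b (coeff-≈ p≈q m)) (sym (coeff-· b q m)))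

  ∷-cong : ∀ {a b p q} → a ≈ b → p ≈ₚ q → a ∷ p ≈ₚ b ∷ q
  ∷-cong a≈b p≈q .coeff-≈ zero    = a≈b
  ∷-cong a≈b p≈q .coeff-≈ (suc m) = coeff-≈ p≈q m

  0∷-+ : ∀ p q → 0# ∷ (p +ₚ q) ≈ₚ (0# ∷ p) +ₚ (0# ∷ q)
  0∷-+ p q = ∷-cong (sym (+-identityˡ 0#)) P.refl

  ·-distribˡ : ∀ a p q → a · (p +ₚ q) ≈ₚ a · p +ₚ a · q
  ·-distribˡ a p q .coeff-≈ m = begin
    coeff (a · (p +ₚ q)) m                ≈⟨ coeff-· a (p +ₚ q) m ⟩
    a * coeff (p +ₚ q) m                  ≈⟨ *-congˡ (coeff-+ p q m) ⟩
    a * (coeff p m + coeff q m)           ≈⟨ distribˡ _ _ _ ⟩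
    a * coeff p m + a * coeff q m         ≈⟨ +-cong (coeff-· a p m) (coeff-· a q m) ⟨
    coeff (a · p) m + coeff (a · q) m     ≈⟨ coeff-+ (a · p) (a · q) m ⟨
    coeff (a · p +ₚ a · q) m              ∎
    where open SetoidReasoning setoid

  ·-assoc : ∀ a b p → (a * b) · p ≈ₚ a · (b · p)
  ·-assoc a b p .coeff-≈ m = begin
    coeff ((a * b) · p) m    ≈⟨ coeff-· (a * b) p m ⟩
    a * b * coeff p m        ≈⟨ *-assoc _ _ _ ⟩
    a * (b * coeff p m)      ≈⟨ *-congˡ (coeff-· b p m) ⟨
    a * coeff (b · p) m      ≈⟨ coeff-· a (b · p) m ⟨
    coeff (a · (b · p)) m    ∎
    where open SetoidReasoning setoid

  ·-identityˡ : ∀ p → 1# · p ≈ₚ p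
  ·-identityˡ p .coeff-≈ m = trans (coeff-· 1# p m) (*-identityˡ _)

  ·-*-assoc : ∀ a p q → (a · p) *ₚ q ≈ₚ a · (p *ₚ q)
  ·-*-assoc a []      q = P.refl
  ·-*-assoc a (b ∷ p) q = ≈ₚ.begin
    (a * b) · q +ₚ (0# ∷ (a · p) *ₚ q)
      ≈ₚ.≈⟨ P.+-cong (·-assoc a b q) (∷-cong (sym (zeroʳ a)) (·-*-assoc a p q)) ⟩
    a · (b · q) +ₚ a · (0# ∷ p *ₚ q)
      ≈ₚ.≈⟨ ·-distribˡ a (b · q) (0# ∷ p *ₚ q) ⟨
    a · (b · q +ₚ (0# ∷ p *ₚ q))
      ≈ₚ.∎

  *-·-assoc : ∀ a p q → p *ₚ (a · q) ≈ₚ a · (p *ₚ q)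
  *-·-assoc a p q = P.trans (P.*-comm p (a · q))
    (P.trans (·-*-assoc a q p) (·-cong refl (P.*-comm q p)))

  -- Scalars and finite sums; the formal derivative and its product rule.

  open CommutativeMonoidMult +-commutativeMonoid using (×-congʳ; ×-congˡ; ×-distrib-+)
    renaming (_×_ to _×ₙ_)
  module Sum = SemiringSum P.semiring

  ·-sum : ∀ {n} a (t : Fin n → Poly) → a · sumₚ t ≈ₚ sumₚ (λ i → a · t i)
  ·-sum {zero}  a t = P.refl
  ·-sum {suc n} a t =
    P.trans (·-distribˡ a (t zero) (sumₚ (t ∘ suc))) (P.+-congˡ {a · t zero} (·-sum a (t ∘ suc)))

  -- The auxiliary function of d/dx is local to it; abstracting its arguments
  -- in a value of d/dx lets unification give it a name.
  mutual
    d/dx-from : Carrier → Poly → ℕ → Poly → Poly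
    d/dx-from = _

    d/dx-∷∷ : ∀ a b p → d/dx (a ∷ b ∷ p) ≡ (1 ×ₙ b) ∷ d/dx-from a (b ∷ p) 2 p
    d/dx-∷∷ a b p with b ∷ p | 2
    ... | _ | _ = ≡.refl

  ×-zeroʳ : ∀ n → n ×ₙ 0# ≈ 0#
  ×-zeroʳ zero    = refl
  ×-zeroʳ (suc n) = trans (+-identityˡ _) (×-zeroʳ n)

  coeff-d/dx-from : ∀ a p k q m → coeff (d/dx-from a p k q) m ≈ (m ℕ.+ k) ×ₙ coeff q m
  coeff-d/dx-from a p k []      m       = sym (×-zeroʳ (m ℕ.+ k))
  coeff-d/dx-from a p k (b ∷ q) zero    = refl
  coeff-d/dx-from a p k (b ∷ q) (suc m) =
    trans (coeff-d/dx-from a p (suc k) q m) (×-congˡ (ℕ.+-suc m k))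

  coeff-d/dx : ∀ p m → coeff (d/dx p) m ≈ suc m ×ₙ coeff p (suc m)
  coeff-d/dx []      m = sym (×-zeroʳ (suc m))
  coeff-d/dx (a ∷ p) m = trans (coeff-d/dx-from a p 1 p m) (×-congˡ (ℕ.+-comm m 1))

  d/dx-cong : ∀ {p q} → p ≈ₚ q → d/dx p ≈ₚ d/dx q
  d/dx-cong {p} {q} p≈q .coeff-≈ m = trans (coeff-d/dx p m)
    (trans (×-congʳ (suc m) (coeff-≈ p≈q (suc m))) (sym (coeff-d/dx q m)))

  -- This is (a + x p)′ = p + x p′, the form suited to induction on coefficient lists.
  d/dx-∷ : ∀ a p → d/dx (a ∷ p) ≈ₚ p +ₚ (0# ∷ d/dx p)
  d/dx-∷ a p .coeff-≈ m = trans (coeff-d/dx (a ∷ p) m)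
    (trans (+-congˡ (shifted m)) (sym (coeff-+ p (0# ∷ d/dx p) m)))
    where
    shifted : ∀ m → m ×ₙ coeff p m ≈ coeff (0# ∷ d/dx p) m
    shifted zero    = refl
    shifted (suc m) = sym (coeff-d/dx p m)

  d/dx-+ : ∀ p q → d/dx (p +ₚ q) ≈ₚ d/dx p +ₚ d/dx q
  d/dx-+ p q .coeff-≈ m = begin
    coeff (d/dx (p +ₚ q)) m                          ≈⟨ coeff-d/dx (p +ₚ q) m ⟩
    suc m ×ₙ coeff (p +ₚ q) (suc m)                   ≈⟨ ×-congʳ (suc m) (coeff-+ p q (suc m)) ⟩
    suc m ×ₙ (coeff p (suc m) + coeff q (suc m))
      ≈⟨ ×-distrib-+ _ _ (suc m) ⟩
    suc m ×ₙ coeff p (suc m) + suc m ×ₙ coeff q (suc m) ≈⟨ +-cong (coeff-d/dx p m) (coeff-d/dx q m) ⟨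
    coeff (d/dx p) m + coeff (d/dx q) m              ≈⟨ coeff-+ (d/dx p) (d/dx q) m ⟨
    coeff (d/dx p +ₚ d/dx q) m                       ∎
    where open SetoidReasoning setoid

  d/dx-· : ∀ a p → d/dx (a · p) ≈ₚ a · d/dx p
  d/dx-· a []      = P.refl
  d/dx-· a (b ∷ p) = ≈ₚ.begin
    d/dx (a * b ∷ a · p)           ≈ₚ.≈⟨ d/dx-∷ (a * b) (a · p) ⟩
    a · p +ₚ (0# ∷ d/dx (a · p))   ≈ₚ.≈⟨ P.+-congˡ {a · p} (∷-cong (sym (zeroʳ a)) (d/dx-· a p)) ⟩
    a · p +ₚ a · (0# ∷ d/dx p)     ≈ₚ.≈⟨ ·-distribˡ a p (0# ∷ d/dx p) ⟨
    a · (p +ₚ (0# ∷ d/dx p))       ≈ₚ.≈⟨ ·-cong refl (d/dx-∷ b p) ⟨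
    a · d/dx (b ∷ p)               ≈ₚ.∎

  -- Induction on the first factor, written a + x p: both sides expand to a q′ + p q + x p′ q + x p
  -- q′.
  d/dx-* : ∀ p q → d/dx (p *ₚ q) ≈ₚ d/dx p *ₚ q +ₚ p *ₚ d/dx q
  d/dx-* []      q = P.refl
  d/dx-* (a ∷ p) q = ≈ₚ.begin
    d/dx (a · q +ₚ (0# ∷ p *ₚ q))
      ≈ₚ.≈⟨ d/dx-+ (a · q) (0# ∷ p *ₚ q) ⟩
    d/dx (a · q) +ₚ d/dx (0# ∷ p *ₚ q)
      ≈ₚ.≈⟨ P.+-cong (d/dx-· a q) (P.trans (d/dx-∷ 0# (p *ₚ q)) (P.+-congˡ {p *ₚ q}
             (P.trans (∷-cong refl (d/dx-* p q)) (0∷-+ (d/dx p *ₚ q) (p *ₚ d/dx q))))) ⟩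
    a · d/dx q +ₚ (p *ₚ q +ₚ ((0# ∷ d/dx p *ₚ q) +ₚ (0# ∷ p *ₚ d/dx q)))
      ≈ₚ.≈⟨ P.+-congˡ {a · d/dx q} (P.+-assoc (p *ₚ q) (0# ∷ d/dx p *ₚ q) (0# ∷ p *ₚ d/dx q)) ⟨
    a · d/dx q +ₚ ((p *ₚ q +ₚ (0# ∷ d/dx p *ₚ q)) +ₚ (0# ∷ p *ₚ d/dx q))
      ≈ₚ.≈⟨ x∙yz≈y∙xz (a · d/dx q) (p *ₚ q +ₚ (0# ∷ d/dx p *ₚ q)) (0# ∷ p *ₚ d/dx q) ⟩
    (p *ₚ q +ₚ (0# ∷ d/dx p *ₚ q)) +ₚ (a ∷ p) *ₚ d/dx q
      ≈ₚ.≈⟨ P.+-congʳ (P.+-congˡ {p *ₚ q} 0∷-*) ⟨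
    (p *ₚ q +ₚ (0# ∷ d/dx p) *ₚ q) +ₚ (a ∷ p) *ₚ d/dx q
      ≈ₚ.≈⟨ P.+-congʳ (P.distribʳ q p (0# ∷ d/dx p)) ⟨
    (p +ₚ (0# ∷ d/dx p)) *ₚ q +ₚ (a ∷ p) *ₚ d/dx q
      ≈ₚ.≈⟨ P.+-congʳ (P.*-congʳ {q} (d/dx-∷ a p)) ⟨
    d/dx (a ∷ p) *ₚ q +ₚ (a ∷ p) *ₚ d/dx q
      ≈ₚ.∎
    where
    open CommutativeSemigroupProperties
      (CommutativeMonoid.commutativeSemigroup P.+-commutativeMonoid) using (x∙yz≈y∙xz)

    0∷-* : (0# ∷ d/dx p) *ₚ q ≈ₚ 0# ∷ d/dx p *ₚ q
    0∷-* .coeff-≈ m = trans (coeff-+ (0# · q) _ m)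
      (trans (+-congʳ (trans (coeff-· 0# q m) (zeroˡ _))) (+-identityˡ _))

  -- Reciprocals of series with constant term 1.

  private module C = Convolution polyRing

  -- The vector lists coefficients from the highest down, and its tail is the vector built for the
  -- preceding `n`; hence all lengths agree on a single series.
  inverseUpTo-lookup : ∀ f n i → Vec.lookup (inverseUpTo f n) i ≡ inverse f (n ∸ toℕ i)
  inverseUpTo-lookup f zero    zero    = ≡.refl
  inverseUpTo-lookup f (suc n) zero    = ≡.refl
  inverseUpTo-lookup f (suc n) (suc i) = inverseUpTo-lookup f n i

  -- Each new coefficient of the inverse is by construction minus the sum of the other terms of the
  -- convolution, so the two cancel once `f 0` is replaced by 1.
  *ₛ-inverse : ∀ f → f 0 ≈ₚ 1ₚ → f *ₛ inverse f ≈ₛ C.unit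
  *ₛ-inverse f f₀≈1 zero =
    P.trans (P.+-identityʳ _) (P.trans (P.*-identityʳ _) f₀≈1)
  *ₛ-inverse f f₀≈1 (suc n) = ≈ₚ.begin
    f 0 *ₚ (-ₚ s) +ₚ (f ∘ suc *ₛ inverse f) n
      ≈ₚ.≈⟨ P.+-cong (P.trans (P.*-congʳ { -ₚ s} f₀≈1) (P.*-identityˡ _))
             (Sum.sum-cong-≋ {suc n} λ i → P.*-congˡ {f (suc (toℕ i))}
               (P.reflexive (≡.sym (inverseUpTo-lookup f n i)))) ⟩
    -ₚ s +ₚ s
      ≈ₚ.≈⟨ P.-‿inverseˡ s ⟩
    0ₚ
      ≈ₚ.∎
    where s = sumₚ (λ i → f (suc (toℕ i)) *ₚ Vec.lookup (inverseUpTo f n) i)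

-- Arithmetic of the weights.

module WeightedHessenberg
  (𝔽 : HeytingField c ℓ₁ ℓ₂)
  (ρ : ℕ → HeytingField.Carrier 𝔽)
  (ρ#0 : ∀ n → HeytingField._#_ 𝔽 (ρ n) (HeytingField.0# 𝔽))
  (ρ₀≈1 : HeytingField._≈_ 𝔽 (ρ 0) (HeytingField.1# 𝔽))
  (K : ℕ → Polynomials.Poly 𝔽)
  where

  open HeytingField 𝔽 using (_#_; heytingCommutativeRing; #⇒invertible)
  open Polynomials 𝔽
  open PolynomialRing 𝔽
  open Hessenberg 𝔽 ρ ρ#0 K
  open HeytingProperties heytingCommutativeRing using (x-0≈x; x#0y#0→xy#0)
  open CommutativeRing fieldRing hiding (zero)
  open CommutativeSemigroupProperties *-commutativeSemigroup using (x∙yz≈y∙xz; xy∙z≈y∙xz; interchange)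

  private
    module P = CommutativeRing polyRing
    module C = Convolution polyRing
    module ≈ₚ = SetoidReasoning P.setoid
    module ≈ = SetoidReasoning setoid

  open HessenbergDeterminant polyRing

  divide-cancel : ∀ x y (y#0 : y # 0#) → y * divide x y y#0 ≈ x
  divide-cancel x y y#0 = ≈.begin
    y * (x * y⁻¹)           ≈.≈⟨ x∙yz≈y∙xz y x y⁻¹ ⟩
    x * (y * y⁻¹)           ≈.≈⟨ *-congˡ (*-congʳ (x-0≈x y)) ⟨
    x * ((y - 0#) * y⁻¹)    ≈.≈⟨ *-congˡ (proj₂ (proj₂ (#⇒invertible y#0))) ⟩
    x * 1#                  ≈.≈⟨ *-identityʳ x ⟩
    x                       ≈.∎
    where y⁻¹ = proj₁ (#⇒invertible y#0)

  1/ρ : ℕ → Carrier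
  1/ρ n = divide 1# (ρ n) (ρ#0 n)

  ρ*1/ρ : ∀ n → ρ n * 1/ρ n ≈ 1#
  ρ*1/ρ n = divide-cancel 1# (ρ n) (ρ#0 n)

  -- Giving each index of the denominator its own factor is what lets weighted sums become Cauchy
  -- products. The quotient is multiplied by (ρ_j/ρ_j)(ρ_k/ρ_k) = 1 and regrouped.
  weight≈ : ∀ i j k → weight i j k ≈ ρ i * (1/ρ j * 1/ρ k)
  weight≈ i j k = ≈.begin
    w                                          ≈.≈⟨ *-identityʳ w ⟨
    w * 1#                                     ≈.≈⟨ *-congˡ (*-identityʳ 1#) ⟨
    w * (1# * 1#)                              ≈.≈⟨ *-congˡ (*-cong (ρ*1/ρ j) (ρ*1/ρ k)) ⟨
    w * ((ρ j * 1/ρ j) * (ρ k * 1/ρ k))        ≈.≈⟨ *-congˡ (interchange (ρ j) (1/ρ j) (ρ k) (1/ρ k)) ⟩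
    w * ((ρ j * ρ k) * (1/ρ j * 1/ρ k))        ≈.≈⟨ xy∙z≈y∙xz (ρ j * ρ k) w (1/ρ j * 1/ρ k) ⟨
    (ρ j * ρ k) * w * (1/ρ j * 1/ρ k)
      ≈.≈⟨ *-congʳ (divide-cancel (ρ i) (ρ j * ρ k) (x#0y#0→xy#0 (ρ#0 j) (ρ#0 k))) ⟩
    ρ i * (1/ρ j * 1/ρ k)                      ≈.∎
    where w = weight i j k

  -- From ρ_0 = 1; it makes the first column of `H` consist of the bare polynomials K_(i-1).
  weight₀ : ∀ n → weight n 0 n ≈ 1#
  weight₀ n = ≈.begin
    weight n 0 n            ≈.≈⟨ weight≈ n 0 n ⟩
    ρ n * (1/ρ 0 * 1/ρ n)   ≈.≈⟨ x∙yz≈y∙xz (ρ n) (1/ρ 0) (1/ρ n) ⟩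
    1/ρ 0 * (ρ n * 1/ρ n)   ≈.≈⟨ *-cong 1/ρ₀≈1 (ρ*1/ρ n) ⟩
    1# * 1#                 ≈.≈⟨ *-identityʳ 1# ⟩
    1#                      ≈.∎
    where
    1/ρ₀≈1 : 1/ρ 0 ≈ 1#
    1/ρ₀≈1 = trans (sym (*-identityˡ _)) (trans (*-congʳ (sym ρ₀≈1)) (ρ*1/ρ 0))

  ρ·1/ρ· : ∀ n p → ρ n · (1/ρ n · p) ≈ₚ p
  ρ·1/ρ· n p = P.trans (P.sym (·-assoc (ρ n) (1/ρ n) p))
    (P.trans (·-cong (ρ*1/ρ n) P.refl) (·-identityˡ p))

  -- Matrix entries, and the recurrences satisfied by the determinants.

  h-lower : ∀ {i j} → j ≤ i → h i j ≡ weight i (j ∸ 1) (suc i ∸ j) · K (i ∸ j)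
  h-lower {i} {j} j≤i rewrite dec-true (j ℕ.≤? i) j≤i = ≡.refl

  h-superdiagonal : ∀ i → h i (suc i) ≡ -ₚ 1ₚ
  h-superdiagonal i
    rewrite dec-false (suc i ℕ.≤? i) ℕ.1+n≰n | dec-true (i ℕ.≟ i) ≡.refl = ≡.refl

  h-above : ∀ {i j} → suc i < j → h i j ≡ 0ₚ
  h-above {i} {j} 1+i<j
    rewrite dec-false (j ℕ.≤? i) (λ j≤i → ℕ.<-irrefl ≡.refl (ℕ.<-trans 1+i<j (s≤s j≤i)))
          | dec-false (j ℕ.≟ suc i) (λ j≡1+i → ℕ.<-irrefl (≡.sym j≡1+i) 1+i<j) = ≡.refl

  -- The kernel shared by all the recurrences. The index of `K` is written so that it agrees by
  -- computation with the one in `recurrence`; the matrix entries have `m ∸ suc (toℕ i)` instead.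
  κ : ∀ m → Fin m → Poly
  κ m i = weight (suc m) (suc (toℕ i)) (m ∸ toℕ i) · K (m ∸ toℕ i ∸ 1)

  history : (ℕ → Poly) → ℕ → Poly
  history a m = sumₚ {m} (λ i → κ m i *ₚ a (suc (toℕ i)))

  -- The equations for the terms of index m + 1; a 0 plays no role.
  record Solves (u a : ℕ → Poly) : Set ℓ₁ where
    constructor solution
    field
      solves : ∀ m → a (suc m) ≈ₚ u m +ₚ history a m
  open Solves public

  recurrence≈ : ∀ a m → recurrence a (suc m) ≈ₚ d/dx (K m) +ₚ history a m
  recurrence≈ a m = P.+-congˡ {d/dx (K m)} (Sum.sum-cong-≋ {m} λ i →
    P.sym (·-*-assoc (weight (suc m) (suc (toℕ i)) (m ∸ toℕ i)) (K (m ∸ toℕ i ∸ 1)) (a (suc (toℕ i)))))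

  h≡κ : ∀ m (i : Fin m) → h (suc m) (suc (suc (toℕ i))) ≡ κ m i
  h≡κ m i = ≡.trans (h-lower (s≤s (toℕ<n i)))
    (≡.cong (λ k → weight (suc m) (suc (toℕ i)) (m ∸ toℕ i) · K k)
      (≡.sym (ℕ.pred[m∸n]≡m∸[1+n] m (toℕ i))))

  -- Replacing the first column changes only the inhomogeneous term; the kernel comes from the
  -- remaining columns.
  det-H[_] : ∀ v → Solves (v ∘ suc) (λ n → det (H[ v ] n))
  det-H[ v ] .solves m = P.trans
    -- Arrays are indexed from 0 and `h` from 1, hence the successors.
    (det-recurrence {λ i j → if suc j ≡ᵇ 1 then v (suc i) else h (suc i) (suc j)}
      ( (λ i → P.reflexive (h-superdiagonal (suc i)))
      , (λ { i (suc j) 1+i<j → P.reflexive (h-above (s≤s 1+i<j)) })) m)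
    (P.+-congˡ {v (suc m)} (Sum.sum-cong-≋ {m} λ i →
      P.*-congʳ {det (H[ v ] (suc (toℕ i)))} (P.reflexive (h≡κ m i))))

  F-solves : Solves K F
  F-solves .solves m = P.trans
    (det-recurrence {λ i j → h (suc i) (suc j)}
      ( (λ i → P.reflexive (h-superdiagonal (suc i)))
      , (λ i j 1+i<j → P.reflexive (h-above (s≤s 1+i<j)))) m)
    (P.+-cong
      (P.trans (·-cong (weight₀ (suc m)) P.refl) (·-identityˡ (K m)))
      (Sum.sum-cong-≋ {m} λ i →
        P.*-congʳ {F (suc (toℕ i))} (P.reflexive (h≡κ m i))))

  solution-unique : ∀ {u a b} → Solves u a → Solves u b → ∀ m → a (suc m) ≈ₚ b (suc m)
  solution-unique {u} {a} {b} a-solves b-solves =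
    recurrence-unique u κ {a} {b} (solves a-solves) (solves b-solves)

  -- Translation between recurrences and generating functions.

  k : Series
  k m = 1/ρ (suc m) · K m

  -- The constant term `p` contributes `p *ₚ K m`. In the term of index j the factors 1/ρ_j and
  -- 1/ρ_(m+1-j) combine with ρ_(m+1) into the weight of the kernel.
  ρ·convolution : ∀ p a m →
    ρ (suc m) · (series p a *ₛ k) m ≈ₚ p *ₚ K m +ₚ history a m
  ρ·convolution p a m = ≈ₚ.begin
    ρ (suc m) · (p *ₚ k m +ₚ sumₚ {m} t)
      ≈ₚ.≈⟨ ·-distribˡ (ρ (suc m)) (p *ₚ k m) (sumₚ {m} t) ⟩
    ρ (suc m) · (p *ₚ k m) +ₚ ρ (suc m) · sumₚ {m} t
      ≈ₚ.≈⟨ P.+-cong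
             (P.trans (P.sym (*-·-assoc (ρ (suc m)) p (k m)))
               (P.*-congˡ {p} (ρ·1/ρ· (suc m) (K m))))
             (P.trans (·-sum {m} (ρ (suc m)) t) (Sum.sum-cong-≋ {m} term≈)) ⟩
    p *ₚ K m +ₚ history a m
      ≈ₚ.∎
    where
    t : Fin m → Poly
    t i = series p a (suc (toℕ i)) *ₚ k (m ∸ suc (toℕ i))

    term≈ : ∀ i → ρ (suc m) · t i ≈ₚ κ m i *ₚ a (suc (toℕ i))
    term≈ i = ≈ₚ.begin
      ρ (suc m) · ((1/ρ j · a j) *ₚ (1/ρ (suc n) · K n))
        ≈ₚ.≈⟨ ·-cong refl (P.trans (·-*-assoc (1/ρ j) (a j) (k n))
               (·-cong refl (P.trans (*-·-assoc (1/ρ (suc n)) (a j) (K n))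
                 (·-cong refl (P.*-comm (a j) (K n)))))) ⟩
      ρ (suc m) · (1/ρ j · (1/ρ (suc n) · (K n *ₚ a j)))
        ≈ₚ.≈⟨ ·-cong refl (·-assoc (1/ρ j) (1/ρ (suc n)) (K n *ₚ a j)) ⟨
      ρ (suc m) · ((1/ρ j * 1/ρ (suc n)) · (K n *ₚ a j))
        ≈ₚ.≈⟨ ·-assoc (ρ (suc m)) (1/ρ j * 1/ρ (suc n)) (K n *ₚ a j) ⟨
      (ρ (suc m) * (1/ρ j * 1/ρ (suc n))) · (K n *ₚ a j)
        ≈ₚ.≈⟨ ·-cong (weight≈ (suc m) j (suc n)) P.refl ⟨
      weight (suc m) j (suc n) · (K n *ₚ a j)
        ≈ₚ.≈⟨ ·-*-assoc (weight (suc m) j (suc n)) (K n) (a j) ⟨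
      (weight (suc m) j (suc n) · K n) *ₚ a j
        -- Here `suc (m ∸ j)` equals `suc m ∸ j` because j is at most m, so the truncated
        -- subtraction is exact.
        ≈ₚ.≡⟨ ≡.cong (λ l → (weight (suc m) j l · K (l ∸ 1)) *ₚ a j)
                (≡.sym (ℕ.+-∸-assoc 1 (toℕ<n i))) ⟩
      κ m i *ₚ a j
        ≈ₚ.∎
      where
      j = suc (toℕ i)
      n = m ∸ j

  f : Series
  f = series 1ₚ F

  -- The identity f = 1 + z k f: the constant term 1 of `f` yields exactly the inhomogeneous term
  -- `K m` of the recurrence for `F`.
  f-suc : ∀ m → f (suc m) ≈ₚ (f *ₛ k) m
  f-suc m = ≈ₚ.begin
    1/ρ (suc m) · F (suc m)
      ≈ₚ.≈⟨ ·-cong refl (P.trans (solves F-solves m) (P.+-congʳ (P.sym (P.*-identityˡ (K m))))) ⟩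
    1/ρ (suc m) · (1ₚ *ₚ K m +ₚ history F m)
      ≈ₚ.≈⟨ ·-cong refl (ρ·convolution 1ₚ F m) ⟨
    1/ρ (suc m) · (ρ (suc m) · (f *ₛ k) m)
      ≈ₚ.≈⟨ ·-assoc (1/ρ (suc m)) (ρ (suc m)) ((f *ₛ k) m) ⟨
    (1/ρ (suc m) * ρ (suc m)) · (f *ₛ k) m
      ≈ₚ.≈⟨ ·-cong (trans (*-comm _ _) (ρ*1/ρ (suc m))) P.refl ⟩
    1# · (f *ₛ k) m
      ≈ₚ.≈⟨ ·-identityˡ _ ⟩
    (f *ₛ k) m
      ≈ₚ.∎

  -- `Log.l` is `∂/∂x-ln f` by definition. The constant term of `f` is the polynomial 1, whose
  -- derivative computes to 0, so the conditions on it hold by reflexivity.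
  module Log = C.Derivation.LogarithmicDerivative
    d/dx d/dx-cong P.refl d/dx-+ d/dx-*
    f (inverse f) k P.refl P.refl f-suc (*ₛ-inverse f P.refl)

  -- Clears denominators in s = z v + z k s. The constant term of `s` is 0, so the head of the
  -- convolution vanishes and only the history remains.
  ρ·series-solves : ∀ {u v a : ℕ → Poly} {s : Series} → s ≈ₛ series 0ₚ a →
    (∀ m → s (suc m) ≈ₚ v m +ₚ (s *ₛ k) m) →
    (∀ m → ρ (suc m) · v m ≈ₚ u m) →
    Solves u a
  ρ·series-solves {u} {v} {a} {s} s≈a s-suc ρv≈u .solves m = ≈ₚ.begin
    a (suc m)
      ≈ₚ.≈⟨ ρ·1/ρ· (suc m) (a (suc m)) ⟨
    ρ (suc m) · series 0ₚ a (suc m)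
      ≈ₚ.≈⟨ ·-cong refl (P.trans (P.sym (s≈a (suc m))) (s-suc m)) ⟩
    ρ (suc m) · (v m +ₚ (s *ₛ k) m)
      ≈ₚ.≈⟨ ·-distribˡ (ρ (suc m)) (v m) ((s *ₛ k) m) ⟩
    ρ (suc m) · v m +ₚ ρ (suc m) · (s *ₛ k) m
      ≈ₚ.≈⟨ P.+-cong (ρv≈u m) (P.trans
             (·-cong refl (C.⋆-cong {g = k} s≈a (λ _ → P.refl) m)) (ρ·convolution 0ₚ a m)) ⟩
    u m +ₚ history a m
      ≈ₚ.∎

  L-solves : ∀ {L} → ∂/∂x-ln f ≈ₛ series 0ₚ L → Solves (d/dx ∘ K) L
  L-solves l≈L = ρ·series-solves l≈L Log.l-suc λ m →
    P.trans (·-cong refl (d/dx-· (1/ρ (suc m)) (K m))) (ρ·1/ρ· (suc m) (d/dx (K m)))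

  -- The equation f′ = l + z k f′, in which coefficient m + 1 of l is L_(m+1)/ρ_(m+1).
  dF-solves : ∀ {L} → ∂/∂x-ln f ≈ₛ series 0ₚ L → Solves (L ∘ suc) (d/dx ∘ F)
  dF-solves {L} l≈L = ρ·series-solves {s = d/dx ∘ f}
    (λ { zero → P.refl ; (suc m) → d/dx-· (1/ρ (suc m)) (F (suc m)) })
    Log.Df-suc
    (λ m → P.trans (·-cong refl (l≈L (suc m))) (ρ·1/ρ· (suc m) (L (suc m))))

  -- The recurrence as stated, and the conclusion.

  solves-cong : ∀ {u a b} → (∀ m → a (suc m) ≈ₚ b (suc m)) → Solves u b → Solves u a
  solves-cong {u} {a} {b} a≈b b-solves .solves m = P.trans (a≈b m) (P.trans (solves b-solves m)
    (P.+-congˡ {u m} (Sum.sum-cong-≋ {m} λ i → P.*-congˡ {κ m i} (P.sym (a≈b (toℕ i))))))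

  recurrence⇔Solves : ∀ a → (∀ m → a (suc m) ≈ₚ recurrence a (suc m)) ⇔ Solves (d/dx ∘ K) a
  recurrence⇔Solves a = mk⇔
    (λ a-rec → solution λ m → P.trans (a-rec m) (recurrence≈ a m))
    (λ a-solves m → P.trans (solves a-solves m) (P.sym (recurrence≈ a m)))

theorem2p1 : ∀ {c ℓ₁ ℓ₂} (𝔽 : HeytingField c ℓ₁ ℓ₂) →
    let open HeytingField 𝔽
        open Polynomials 𝔽
    in
    (ρ : ℕ → Carrier) (ρ#0 : ∀ n → ρ n # 0#) → ρ 0 ≈ 1# →
    (K : ℕ → Poly) →
    let open Hessenberg 𝔽 ρ ρ#0 K in
    (L : ℕ → Poly) →
    ∂/∂x-ln (series 1ₚ F) ≈ₛ series 0ₚ L →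
    (∀ n → n ≥ 1 → d/dx (F n) ≈ₚ det (H[ L ] n))
    × (∀ n → n ≥ 1 → L n ≈ₚ det (H[ (λ i → d/dx (K (i ∸ 1))) ] n))
    × (∀ n → n ≥ 1 → L n ≈ₚ recurrence L n)
    × ((a : ℕ → Poly) →
       (∀ n → n ≥ 1 → a n ≈ₚ det (H[ (λ i → d/dx (K (i ∸ 1))) ] n))
       ⇔ (∀ n → n ≥ 1 → a n ≈ₚ recurrence a n))
theorem2p1 𝔽 ρ ρ#0 ρ₀≈1 K L l≈L =
    -- Both sides solve the system with inhomogeneous term L_(m+1), and solutions are unique.
    from-suc (solution-unique (dF-solves l≈L) det-H[ L ])
  , from-suc (solution-unique (L-solves l≈L) det-H[ K′ ])
  , from-suc (from (recurrence⇔Solves L) (L-solves l≈L))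
  -- For arbitrary `a`: forwards, the recurrence of the determinants is transported along the
  -- equality; backwards, uniqueness applies.
  , λ a → mk⇔
      (λ a≈det → from-suc (from (recurrence⇔Solves a)
        (solves-cong (to-suc a≈det) det-H[ K′ ])))
      (λ a-rec → from-suc (solution-unique
        (to (recurrence⇔Solves a) (to-suc a-rec)) det-H[ K′ ]))
  where
  open Polynomials 𝔽
  open WeightedHessenberg 𝔽 ρ ρ#0 ρ₀≈1 K
  open Equivalence using (to; from)

  -- Numbered from 1 like the rows, so that `K′ ∘ suc` computes to `d/dx ∘ K`.
  K′ : ℕ → Poly
  K′ i = d/dx (K (i ∸ 1))

  from-suc : ∀ {p} {P : ℕ → Set p} → (∀ m → P (suc m)) → ∀ n → n ≥ 1 → P n
  from-suc P-suc (suc m) _ = P-suc m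

  to-suc : ∀ {p} {P : ℕ → Set p} → (∀ n → n ≥ 1 → P n) → ∀ m → P (suc m)
  to-suc P-pos m = P-pos (suc m) (s≤s z≤n)
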